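{- There exists a finite planar graph $G''$ whose hat guessing number satisfies $\mathrm{HG}(G'')\geq 14$.
   Context: Hat guessing game: sages sit at the vertices of a finite simple graph $G$ (the visibility graph). Each sage $v$ receives a hat whose color is one of $k$ colors, and sees only the hat colors of the sages at adjacent vertices (not his own). The sages do not communicate; beforehand they fix a deterministic strategy, i.e. for each vertex $v$ a function from the colorings of the neighbors of $v$ to a guess for the color of $v$'s own hat. The strategy is winning if for every assignment of colors to all vertices at least one sage guesses his own color correctly. The hat guessing number $\mathrm{HG}(G)$ is the largest $k$ for which the sages have a winning strategy. -}

module Defs where

open import Data.Nat using (ℕ)
open import Data.Fin using (Fin)
open import Data.Bool using (Bool; true; false)
open import Data.Integer using (ℤ; _-_; _*_; _<_; _≤_; _⊓_; _⊔_; 0ℤ)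
open import Data.Product using (_×_; _,_; Σ; ∃; proj₁; proj₂)
open import Data.Sum using (_⊎_)
open import Relation.Binary.PropositionalEquality using (_≡_; _≢_)
open import Relation.Nullary using (¬_)

record Graph : Set where
  field
    n      : ℕ
    adj    : Fin n → Fin n → Bool
    sym    : ∀ u v → adj u v ≡ adj v u
    irrefl : ∀ v → adj v v ≡ false

open Graph public

Adj : (G : Graph) → Fin (n G) → Fin (n G) → Set
Adj G u v = adj G u v ≡ true

Colouring : Graph → ℕ → Set
Colouring G k = Fin (n G) → Fin k

record Strategy (G : Graph) (k : ℕ) : Set where
  field
    guess : Fin (n G) → Colouring G k → Fin k
    local : ∀ v (c c′ : Colouring G k) →
            (∀ u → Adj G v u → c u ≡ c′ u) →
            guess v c ≡ guess v c′

open Strategy public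

Winning : (G : Graph) (k : ℕ) → Strategy G k → Set
Winning G k s = ∀ (c : Colouring G k) → ∃ λ v → guess s v c ≡ c v

HasWinningStrategy : Graph → ℕ → Set
HasWinningStrategy G k = Σ (Strategy G k) (Winning G k)

-- HG(G) ≥ m : the largest k admitting a winning strategy is at least m,
-- i.e. some k ≥ m admits a winning strategy.
HG≥ : Graph → ℕ → Set
HG≥ G m = ∃ λ k → (m Data.Nat.≤ k) × HasWinningStrategy G k

-- Planarity, via straight-line drawings with integer coordinates
-- (equivalent to planarity by Fáry's theorem plus perturbation/scaling).

Point : Set
Point = ℤ × ℤ

-- twice the signed area of the triangle p q r
orient : Point → Point → Point → ℤ
orient (px , py) (qx , qy) (rx , ry) =
  ((qx - px) * (ry - py)) - ((qy - py) * (rx - px))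

InBox : Point → Point → Point → Set
InBox (px , py) (qx , qy) (rx , ry) =
  ((px ⊓ qx) ≤ rx × rx ≤ (px ⊔ qx)) × ((py ⊓ qy) ≤ ry × ry ≤ (py ⊔ qy))

OnSegment : Point → Point → Point → Set
OnSegment p q r = (orient p q r ≡ 0ℤ) × InBox p q r

SegmentsMeet : Point → Point → Point → Point → Set
SegmentsMeet p1 p2 q1 q2 =
  ((orient q1 q2 p1 * orient q1 q2 p2) < 0ℤ × (orient p1 p2 q1 * orient p1 p2 q2) < 0ℤ)
  ⊎ OnSegment q1 q2 p1 ⊎ OnSegment q1 q2 p2 ⊎ OnSegment p1 p2 q1 ⊎ OnSegment p1 p2 q2

-- A plane straight-line drawing of G: vertices at distinct points, no vertex
-- in the interior (closed segment) of an edge it is not an endpoint of, and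
-- edges without common endpoint are disjoint.  (Edges sharing an endpoint
-- can then only meet at that endpoint.)
record StraightLineDrawing (G : Graph) : Set where
  field
    pos       : Fin (n G) → Point
    injective : ∀ u v → pos u ≡ pos v → u ≡ v
    vertexOffEdge : ∀ u v w → Adj G u v → w ≢ u → w ≢ v →
                    ¬ OnSegment (pos u) (pos v) (pos w)
    noCrossing : ∀ u v x y → Adj G u v → Adj G x y →
                 u ≢ x → u ≢ y → v ≢ x → v ≢ y →
                 ¬ SegmentsMeet (pos u) (pos v) (pos x) (pos y)

Planar : Graph → Set
Planar G = StraightLineDrawing G

{-# OPTIONS --safe #-}

-- Let x, y be adjacent apexes over a long path, cut into blocks of four vertices.
-- Given (x, y), a block has five strategies at its disposal, and for every colouring of the
-- block one of the five makes some block vertex guess right.  There is a block for every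
-- function h from pairs (x, y) to these five strategies, playing strategy h(x, y).  If five
-- pairs were compatible with all blocks guessing wrong, the block whose h is injective on them
-- would be refuted; so x and y both know a set of at most four candidate pairs.  As a
-- bipartite graph this set has at most one cycle per component, so each candidate pair can be
-- assigned to one of its endpoints, each endpoint being used at most once.

module Submission where

open import Defs
open import Data.Bool using (Bool; true; false; if_then_else_)
open import Data.Fin using (Fin; zero; suc; toℕ; combine; remQuot; inject≤; finToFun; funToFin)
open import Data.Fin.Patterns using (0F; 1F; 2F; 3F)
import Data.Fin as Fin
import Data.Fin.Properties as Fin
open import Data.Integer using (ℤ; +_; -[1+_]; 0ℤ; 1ℤ; -1ℤ; +<+)
import Data.Integer as ℤ
import Data.Integer.Properties as ℤ
open import Data.Integer.Solver using (module +-*-Solver)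
open import Data.List using (List; []; _∷_; length; filter; allFin; cartesianProduct; lookup)
open import Data.List.Membership.Propositional using (_∈_; find)
open import Data.List.Membership.Propositional.Properties
  using (∈-lookup; ∈-filter⁺; ∈-filter⁻; ∈-allFin; ∈-cartesianProduct⁺)
open import Data.List.Relation.Unary.All using (All; []; _∷_)
import Data.List.Relation.Unary.All as All
open import Data.List.Relation.Unary.AllPairs using (_∷_)
import Data.List.Relation.Unary.Any as Any
open import Data.List.Relation.Unary.Any using (any?; here; there)
open import Data.List.Relation.Unary.Unique.Propositional using (Unique)
import Data.List.Relation.Unary.Unique.Propositional.Properties as Unique
open import Data.Nat using (ℕ; zero; suc; _+_; _*_; _^_; _≤_; _<_; _≤?_; s≤s; s≤s⁻¹; parity)
open import Data.Nat.DivMod using (_mod_)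
import Data.Nat.Properties as ℕ
open import Data.Parity using (Parity; 0ℙ; 1ℙ; _⁻¹)
import Data.Parity.Properties as ℙ
open import Data.Product using (Σ; ∃; _×_; _,_; proj₁; proj₂)
open import Data.Product.Properties using (≡-dec)
import Data.Sum as Sum
open import Data.Sum using (_⊎_; inj₁; inj₂; swap)
import Data.Vec as Vec
open import Data.Vec.Properties using (tabulate-cong; lookup∘tabulate)
open import Function using (_∘_; mk⇔)
open import Relation.Binary using (DecidableEquality; tri<; tri≈; tri>)
open import Relation.Binary.PropositionalEquality
  using (_≡_; _≢_; refl; trans; cong; cong₂; subst; subst₂; module ≡-Reasoning)
  renaming (sym to ≡-sym)
open import Relation.Nullary using (¬_; Dec; yes; no; does; contradiction)
open import Relation.Nullary.Decidable
  using (_⊎-dec_; ¬?; from-yes; dec-true; dec-false; does-⇔)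

-- Apexes over a path

Consecutive : ∀ {m} → Fin m → Fin m → Set
Consecutive i j = suc (toℕ i) ≡ toℕ j ⊎ suc (toℕ j) ≡ toℕ i

consecutive? : ∀ {m} (i j : Fin m) → Dec (Consecutive i j)
consecutive? i j = (suc (toℕ i) ℕ.≟ toℕ j) ⊎-dec (suc (toℕ j) ℕ.≟ toℕ i)

doubleFan : ℕ → Graph
doubleFan M = record { n = 2 + M ; adj = adj′ ; sym = sym′ ; irrefl = irrefl′ }
  where
  adj′ : Fin (2 + M) → Fin (2 + M) → Bool
  adj′ 0F            0F            = false
  adj′ 0F            (suc _)       = true
  adj′ (suc _)       0F            = true
  adj′ 1F            1F            = false
  adj′ 1F            (suc (suc _)) = true
  adj′ (suc (suc _)) 1F            = true
  adj′ (suc (suc i)) (suc (suc j)) = does (consecutive? i j)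

  sym′ : ∀ u v → adj′ u v ≡ adj′ v u
  sym′ 0F            0F            = refl
  sym′ 0F            (suc _)       = refl
  sym′ (suc _)       0F            = refl
  sym′ 1F            1F            = refl
  sym′ 1F            (suc (suc _)) = refl
  sym′ (suc (suc _)) 1F            = refl
  sym′ (suc (suc i)) (suc (suc j)) = does-⇔ (mk⇔ swap swap) (consecutive? i j) (consecutive? j i)

  irrefl′ : ∀ v → adj′ v v ≡ false
  irrefl′ 0F            = refl
  irrefl′ 1F            = refl
  irrefl′ (suc (suc i)) = dec-false (consecutive? i i) λ
    { (inj₁ e) → ℕ.1+n≢n e ; (inj₂ e) → ℕ.1+n≢n e }

pathVertex : ∀ {M} → Fin M → Fin (2 + M)
pathVertex i = suc (suc i)

adj⇒consecutive : ∀ {M} {i j : Fin M} →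
                  Adj (doubleFan M) (pathVertex i) (pathVertex j) → Consecutive i j
adj⇒consecutive {i = i} {j} a with consecutive? i j
... | yes c = c
... | no ¬c = contradiction (trans (≡-sym a) (dec-false (consecutive? i j) ¬c)) λ ()

consecutive⇒adj : ∀ {M} {i j : Fin M} →
                  Consecutive i j → Adj (doubleFan M) (pathVertex i) (pathVertex j)
consecutive⇒adj {i = i} {j} = dec-true (consecutive? i j)

-- Plane drawing of the double fan

orient-swap : ∀ p q r → orient q p r ≡ ℤ.- orient p q r
orient-swap (px , py) (qx , qy) (rx , ry) = solve 6
  (λ a b c d e f → (a :- c) :* (f :- d) :- (b :- d) :* (e :- c)
                := :- ((c :- a) :* (f :- b) :- (d :- b) :* (e :- a)))
  refl px py qx qy rx ry
  where open +-*-Solver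

module _ where
  open +-*-Solver

  -- With the apexes on the vertical axis and the path on the horizontal one, these orientations
  -- vanish or are products of coordinates and coordinate differences, so their signs can be read
  -- off.
  orient-spoke-path : ∀ h a b → orient (0ℤ , h) (a , 0ℤ) (b , 0ℤ) ≡ h ℤ.* (b ℤ.- a)
  orient-spoke-path = solve 3 (λ h a b →
    (a :- con 0ℤ) :* (con 0ℤ :- h) :- (con 0ℤ :- h) :* (b :- con 0ℤ) := h :* (b :- a)) refl

  orient-spoke-apex : ∀ h g a → orient (0ℤ , h) (a , 0ℤ) (0ℤ , g) ≡ a ℤ.* (g ℤ.- h)
  orient-spoke-apex = solve 3 (λ h g a →
    (a :- con 0ℤ) :* (g :- h) :- (con 0ℤ :- h) :* (con 0ℤ :- con 0ℤ) := a :* (g :- h)) refl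

  orient-axis-path : ∀ h g a → orient (0ℤ , h) (0ℤ , g) (a , 0ℤ) ≡ a ℤ.* (h ℤ.- g)
  orient-axis-path = solve 3 (λ h g a →
    (con 0ℤ :- con 0ℤ) :* (con 0ℤ :- h) :- (g :- h) :* (a :- con 0ℤ) := a :* (h :- g)) refl

  orient-path-apex : ∀ h a b → orient (a , 0ℤ) (b , 0ℤ) (0ℤ , h) ≡ (b ℤ.- a) ℤ.* h
  orient-path-apex = solve 3 (λ h a b →
    (b :- a) :* (h :- con 0ℤ) :- (con 0ℤ :- con 0ℤ) :* (con 0ℤ :- a) := (b :- a) :* h) refl

  orient-path-path : ∀ a b c → orient (a , 0ℤ) (b , 0ℤ) (c , 0ℤ) ≡ 0ℤ
  orient-path-path = solve 3 (λ a b c →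
    (b :- a) :* (con 0ℤ :- con 0ℤ) :- (con 0ℤ :- con 0ℤ) :* (c :- a) := con 0ℤ) refl

-- The shift by one keeps the path away from the origin, which lies on the edge joining the apexes.
abscissa : ℕ → ℤ
abscissa i = + suc i

abscissa-injective : ∀ {i j} → abscissa i ≡ abscissa j → i ≡ j
abscissa-injective = ℕ.suc-injective ∘ ℤ.+-injective

-- The constructor `-[1+_]` is exposed so that products with this difference compute to a definite
-- sign, and a false inequality is refuted by an absurd pattern.
abscissa-< : ∀ {i j} → i < j → ∃ λ t → abscissa i ℤ.- abscissa j ≡ -[1+ t ]
abscissa-< {zero}  {suc j} _       = j , refl
abscissa-< {suc i} {suc j} (s≤s p) with t , e ← abscissa-< p =
  t , trans (ℤ.[1+m]⊖[1+n]≡m⊖n (suc i) (suc j)) e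

OnOppositeSides : Point → Point → Point → Point → Set
OnOppositeSides p q r s = (orient p q r ℤ.* orient p q s) ℤ.< 0ℤ

ProperlyCross : Point → Point → Point → Point → Set
ProperlyCross p1 p2 q1 q2 = OnOppositeSides q1 q2 p1 p2 × OnOppositeSides p1 p2 q1 q2

properlyCross-comm : ∀ {p1 p2 q1 q2} → ProperlyCross p1 p2 q1 q2 → ProperlyCross q1 q2 p1 p2
properlyCross-comm (a , b) = b , a

properlyCross-swapˡ : ∀ {p1 p2 q1 q2} → ProperlyCross p1 p2 q1 q2 → ProperlyCross p2 p1 q1 q2
properlyCross-swapˡ {p1} {p2} {q1} {q2} (a , b) =
  subst (ℤ._< 0ℤ) (ℤ.*-comm (orient q1 q2 p1) (orient q1 q2 p2)) a ,
  subst (ℤ._< 0ℤ) (begin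
    orient p1 p2 q1 ℤ.* orient p1 p2 q2
      ≡⟨ neg*neg (orient p1 p2 q1) (orient p1 p2 q2) ⟩
    ℤ.- orient p1 p2 q1 ℤ.* ℤ.- orient p1 p2 q2
      ≡⟨ cong₂ ℤ._*_ (orient-swap p1 p2 q1) (orient-swap p1 p2 q2) ⟨
    orient p2 p1 q1 ℤ.* orient p2 p1 q2 ∎) b
  where
  open ≡-Reasoning
  open +-*-Solver
  neg*neg : ∀ i j → i ℤ.* j ≡ ℤ.- i ℤ.* ℤ.- j
  neg*neg = solve 2 (λ i j → i :* j := :- i :* :- j) refl

onSegment-swap : ∀ p q r → OnSegment p q r → OnSegment q p r
onSegment-swap p@(px , py) q@(qx , qy) r (o , (x₁ , x₂) , (y₁ , y₂)) =
  trans (orient-swap p q r) (cong ℤ.-_ o) ,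
  (subst (ℤ._≤ _) (ℤ.⊓-comm px qx) x₁ , subst (_ ℤ.≤_) (ℤ.⊔-comm px qx) x₂) ,
  (subst (ℤ._≤ _) (ℤ.⊓-comm py qy) y₁ , subst (_ ℤ.≤_) (ℤ.⊔-comm py qy) y₂)

*-zero-difference : ∀ h {a b} → h ≢ 0ℤ → h ℤ.* (a ℤ.- b) ≡ 0ℤ → a ≡ b
*-zero-difference h {a} {b} h≢0 e with ℤ.i*j≡0⇒i≡0∨j≡0 h e
... | inj₁ h≡0   = contradiction h≡0 h≢0
... | inj₂ a-b≡0 = ℤ.i-j≡0⇒i≡j a b a-b≡0

-- All path vertices are collinear, so only the box condition of `OnSegment` can keep one of them
-- off a path edge.
between-successive : ∀ {i k} → abscissa i ℤ.⊓ abscissa (suc i) ℤ.≤ abscissa k →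
                     abscissa k ℤ.≤ abscissa i ℤ.⊔ abscissa (suc i) → k ≡ i ⊎ k ≡ suc i
between-successive {i} {k} lo hi
  with ℕ.m≤n⇒m<n∨m≡n (s≤s⁻¹ (ℤ.drop‿+≤+ (subst (ℤ._≤ abscissa k) (ℤ.i≤j⇒i⊓j≡i i≤1+i) lo)))
  where
  i≤1+i : abscissa i ℤ.≤ abscissa (suc i)
  i≤1+i = ℤ.+≤+ (ℕ.n≤1+n (suc i))
... | inj₂ i≡k = inj₁ (≡-sym i≡k)
... | inj₁ i<k = inj₂ (ℕ.≤-antisym
        (s≤s⁻¹ (ℤ.drop‿+≤+ (subst (abscissa k ℤ.≤_) (ℤ.i≤j⇒i⊔j≡j (ℤ.+≤+ (ℕ.n≤1+n (suc i)))) hi)))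
        i<k)

module _ {M : ℕ} where

  place : Fin (2 + M) → Point
  place 0F            = 0ℤ , 1ℤ
  place 1F            = 0ℤ , -1ℤ
  place (suc (suc i)) = abscissa (toℕ i) , 0ℤ

  place-injective : ∀ u v → place u ≡ place v → u ≡ v
  place-injective 0F            0F            _ = refl
  place-injective 0F            1F            ()
  place-injective 0F            (suc (suc _)) ()
  place-injective 1F            0F            ()
  place-injective 1F            1F            _ = refl
  place-injective 1F            (suc (suc _)) ()
  place-injective (suc (suc _)) 0F            ()
  place-injective (suc (suc _)) 1F            ()
  place-injective (suc (suc i)) (suc (suc j)) e =
    cong pathVertex (Fin.toℕ-injective (abscissa-injective (cong proj₁ e)))

  abscissa-toℕ-injective : ∀ {i j : Fin M} → abscissa (toℕ i) ≡ abscissa (toℕ j) →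
                           pathVertex i ≡ pathVertex j
  abscissa-toℕ-injective e = place-injective _ _ (cong (_, 0ℤ) e)

  offEdge-< : ∀ u v w → u Fin.< v → Adj (doubleFan M) u v → w ≢ u → w ≢ v →
              ¬ OnSegment (place u) (place v) (place w)
  offEdge-< _ 0F _ () _ _ _ _
  offEdge-< (suc _) 1F _ (s≤s ()) _ _ _ _
  offEdge-< 0F 1F 0F _ _ w≢u _ _ = w≢u refl
  offEdge-< 0F 1F 1F _ _ _ w≢v _ = w≢v refl
  offEdge-< 0F 1F (suc (suc k)) _ _ _ _ (o , _)
    with () ← trans (≡-sym o) (orient-axis-path 1ℤ -1ℤ (abscissa (toℕ k)))
  offEdge-< 0F (suc (suc i)) 0F _ _ w≢u _ _ = w≢u refl
  offEdge-< 0F (suc (suc i)) 1F _ _ _ _ (o , _)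
    with () ← trans (≡-sym o) (orient-spoke-apex 1ℤ -1ℤ (abscissa (toℕ i)))
  offEdge-< 0F (suc (suc i)) (suc (suc k)) _ _ _ w≢v (o , _) =
    w≢v (abscissa-toℕ-injective (*-zero-difference 1ℤ (λ ())
      (trans (≡-sym (orient-spoke-path 1ℤ (abscissa (toℕ i)) (abscissa (toℕ k)))) o)))
  offEdge-< 1F (suc (suc i)) 1F _ _ w≢u _ _ = w≢u refl
  offEdge-< 1F (suc (suc i)) 0F _ _ _ _ (o , _)
    with () ← trans (≡-sym o) (orient-spoke-apex -1ℤ 1ℤ (abscissa (toℕ i)))
  offEdge-< 1F (suc (suc i)) (suc (suc k)) _ _ _ w≢v (o , _) =
    w≢v (abscissa-toℕ-injective (*-zero-difference -1ℤ (λ ())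
      (trans (≡-sym (orient-spoke-path -1ℤ (abscissa (toℕ i)) (abscissa (toℕ k)))) o)))
  offEdge-< (suc (suc i)) (suc (suc j)) 0F i<j _ _ _ (o , _) =
    Fin.<⇒≢ i<j (abscissa-toℕ-injective (≡-sym (*-zero-difference 1ℤ (λ ())
      (trans (ℤ.*-comm 1ℤ (abscissa (toℕ j) ℤ.- abscissa (toℕ i)))
      (trans (≡-sym (orient-path-apex 1ℤ (abscissa (toℕ i)) (abscissa (toℕ j)))) o)))))
  offEdge-< (suc (suc i)) (suc (suc j)) 1F i<j _ _ _ (o , _) =
    Fin.<⇒≢ i<j (abscissa-toℕ-injective (≡-sym (*-zero-difference -1ℤ (λ ())
      (trans (ℤ.*-comm -1ℤ (abscissa (toℕ j) ℤ.- abscissa (toℕ i)))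
      (trans (≡-sym (orient-path-apex -1ℤ (abscissa (toℕ i)) (abscissa (toℕ j)))) o)))))
  offEdge-< (suc (suc i)) (suc (suc j)) (suc (suc k)) i<j a w≢u w≢v (_ , (lo , hi) , _)
    with adj⇒consecutive {i = i} {j} a
  ... | inj₂ 1+j≡i = ℕ.<⇒≱ (s≤s⁻¹ (s≤s⁻¹ i<j)) (ℕ.<⇒≤ (ℕ.≤-reflexive 1+j≡i))
  ... | inj₁ 1+i≡j
    with between-successive {toℕ i} {toℕ k}
           (subst (λ t → abscissa (toℕ i) ℤ.⊓ abscissa t ℤ.≤ abscissa (toℕ k)) (≡-sym 1+i≡j) lo)
           (subst (λ t → abscissa (toℕ k) ℤ.≤ abscissa (toℕ i) ℤ.⊔ abscissa t) (≡-sym 1+i≡j) hi)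
  ...   | inj₁ k≡i   = w≢u (cong pathVertex (Fin.toℕ-injective k≡i))
  ...   | inj₂ k≡1+i = w≢v (cong pathVertex (Fin.toℕ-injective (trans k≡1+i 1+i≡j)))

  adj-sym : ∀ {u v} → Adj (doubleFan M) u v → Adj (doubleFan M) v u
  adj-sym {u} {v} = trans (sym (doubleFan M) v u)

  adj⇒≢ : ∀ {u v} → Adj (doubleFan M) u v → u ≢ v
  adj⇒≢ {u} a refl with () ← trans (≡-sym a) (irrefl (doubleFan M) u)

  offEdge : ∀ u v w → Adj (doubleFan M) u v → w ≢ u → w ≢ v →
            ¬ OnSegment (place u) (place v) (place w)
  offEdge u v w a w≢u w≢v on with Fin.<-cmp u v
  ... | tri< u<v _ _ = offEdge-< u v w u<v a w≢u w≢v on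
  ... | tri≈ _ u≡v _ = adj⇒≢ a u≡v
  ... | tri> _ _ v<u = offEdge-< v u w v<u (adj-sym {u} {v} a) w≢v w≢u
                         (onSegment-swap (place u) (place v) (place w) on)

  -- The path vertex `k` lies on the line through the other two, so one factor of the product is
  -- zero. Hence no edge ending in a path vertex properly crosses a path edge.
  path-no-opposite-sides : ∀ (i j k : Fin M) r →
    ¬ OnOppositeSides (place (pathVertex i)) (place (pathVertex j)) r (place (pathVertex k))
  path-no-opposite-sides i j k r lt = ℤ.+≮0 (subst (ℤ._< 0ℤ) (begin
    o ℤ.* orient (place (pathVertex i)) (place (pathVertex j)) (place (pathVertex k))
      ≡⟨ cong (o ℤ.*_) (orient-path-path (abscissa (toℕ i)) (abscissa (toℕ j)) (abscissa (toℕ k))) ⟩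
    o ℤ.* 0ℤ
      ≡⟨ ℤ.*-zeroʳ o ⟩
    0ℤ ∎) lt)
    where
    open ≡-Reasoning
    o = orient (place (pathVertex i)) (place (pathVertex j)) r

  -- With both edges ordered and their first endpoints compared, three cases remain: the apex edge
  -- against a path edge, two spokes from different apexes, and an edge ending on the path against a
  -- path edge.
  noCross-< : ∀ u v x y → u Fin.< v → x Fin.< y → u Fin.< x → v ≢ x → v ≢ y →
              ¬ ProperlyCross (place u) (place v) (place x) (place y)
  noCross-< _ 0F _ _ () _ _ _ _
  noCross-< _ _ 0F _ _ _ () _ _
  noCross-< _ _ 1F 1F _ (s≤s ()) _ _ _
  noCross-< _ _ (suc (suc _)) 1F _ (s≤s ()) _ _ _
  noCross-< 0F 1F 1F _ _ _ _ v≢x _ _ = v≢x refl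
  noCross-< 0F 1F (suc (suc i)) (suc (suc j)) _ _ _ _ _ (_ , lt)
    with +<+ () ← subst₂ (λ s t → s ℤ.* t ℤ.< 0ℤ) (orient-axis-path 1ℤ -1ℤ (abscissa (toℕ i)))
                    (orient-axis-path 1ℤ -1ℤ (abscissa (toℕ j))) lt
  -- If `j < i`, apex `1F` and path vertex `j` are on the same side of the spoke from `0F`; if
  -- `i < j`, apex `0F` and path vertex `i` are on the same side of the spoke from `1F`.
  noCross-< 0F (suc (suc i)) 1F (suc (suc j)) _ _ _ _ v≢y (lt′ , lt) with Fin.<-cmp i j
  ... | tri≈ _ i≡j _ = v≢y (cong pathVertex i≡j)
  ... | tri> _ _ j<i
    with t , e ← abscissa-< j<i
    with +<+ () ← subst₂ (λ s t → s ℤ.* t ℤ.< 0ℤ)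
      (orient-spoke-apex 1ℤ -1ℤ (abscissa (toℕ i)))
      (trans (orient-spoke-path 1ℤ (abscissa (toℕ i)) (abscissa (toℕ j))) (cong (1ℤ ℤ.*_) e)) lt
  ... | tri< i<j _ _
    with t , e ← abscissa-< i<j
    with +<+ () ← subst₂ (λ s t → s ℤ.* t ℤ.< 0ℤ)
      (orient-spoke-apex -1ℤ 1ℤ (abscissa (toℕ j)))
      (trans (orient-spoke-path -1ℤ (abscissa (toℕ j)) (abscissa (toℕ i))) (cong (-1ℤ ℤ.*_) e)) lt′
  noCross-< (suc _) 1F _ _ (s≤s ()) _ _ _ _
  noCross-< u (suc (suc k)) (suc (suc i)) (suc (suc j)) _ _ _ _ _ (lt , _) =
    path-no-opposite-sides i j k (place u) lt
  noCross-< (suc _) (suc (suc _)) 1F _ _ _ (s≤s ()) _ _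

  noCross-<< : ∀ u v x y → u Fin.< v → x Fin.< y → u ≢ x → u ≢ y → v ≢ x → v ≢ y →
               ¬ ProperlyCross (place u) (place v) (place x) (place y)
  noCross-<< u v x y u<v x<y u≢x u≢y v≢x v≢y cross with Fin.<-cmp u x
  ... | tri< u<x _ _ = noCross-< u v x y u<v x<y u<x v≢x v≢y cross
  ... | tri≈ _ u≡x _ = u≢x u≡x
  ... | tri> _ _ x<u = noCross-< x y u v x<y u<v x<u (u≢y ∘ ≡-sym) (v≢y ∘ ≡-sym)
                         (properlyCross-comm {place u} {place v} {place x} {place y} cross)

  noCross-<-any : ∀ u v x y → u Fin.< v → Adj (doubleFan M) x y →
                  u ≢ x → u ≢ y → v ≢ x → v ≢ y →
                  ¬ ProperlyCross (place u) (place v) (place x) (place y)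
  noCross-<-any u v x y u<v a u≢x u≢y v≢x v≢y cross with Fin.<-cmp x y
  ... | tri< x<y _ _ = noCross-<< u v x y u<v x<y u≢x u≢y v≢x v≢y cross
  ... | tri≈ _ x≡y _ = adj⇒≢ a x≡y
  ... | tri> _ _ y<x = noCross-<< u v y x u<v y<x u≢y u≢x v≢y v≢x
    (properlyCross-comm {place y} {place x} {place u} {place v}
      (properlyCross-swapˡ {place x} {place y} {place u} {place v}
        (properlyCross-comm {place u} {place v} {place x} {place y} cross)))

  noCross : ∀ u v x y → Adj (doubleFan M) u v → Adj (doubleFan M) x y →
            u ≢ x → u ≢ y → v ≢ x → v ≢ y →
            ¬ ProperlyCross (place u) (place v) (place x) (place y)
  noCross u v x y a b u≢x u≢y v≢x v≢y cross with Fin.<-cmp u v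
  ... | tri< u<v _ _ = noCross-<-any u v x y u<v b u≢x u≢y v≢x v≢y cross
  ... | tri≈ _ u≡v _ = adj⇒≢ a u≡v
  ... | tri> _ _ v<u = noCross-<-any v u x y v<u b v≢x v≢y u≢x u≢y
                         (properlyCross-swapˡ {place u} {place v} {place x} {place y} cross)

  noMeet : ∀ u v x y → Adj (doubleFan M) u v → Adj (doubleFan M) x y →
           u ≢ x → u ≢ y → v ≢ x → v ≢ y →
           ¬ SegmentsMeet (place u) (place v) (place x) (place y)
  noMeet u v x y a b u≢x u≢y v≢x v≢y = λ
    { (inj₁ cross)                      → noCross u v x y a b u≢x u≢y v≢x v≢y cross
    ; (inj₂ (inj₁ on))                  → offEdge x y u b u≢x u≢y on
    ; (inj₂ (inj₂ (inj₁ on)))           → offEdge x y v b v≢x v≢y on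
    ; (inj₂ (inj₂ (inj₂ (inj₁ on))))    → offEdge u v x a (u≢x ∘ ≡-sym) (v≢x ∘ ≡-sym) on
    ; (inj₂ (inj₂ (inj₂ (inj₂ on))))    → offEdge u v y a (u≢y ∘ ≡-sym) (v≢y ∘ ≡-sym) on
    }

doubleFan-planar : ∀ M → Planar (doubleFan M)
doubleFan-planar M = record
  { pos = place ; injective = place-injective ; vertexOffEdge = offEdge ; noCrossing = noMeet }

-- Four pairs are covered by two guessing functions

module Covering {A B : Set} (_≟₁_ : DecidableEquality A) (_≟₂_ : DecidableEquality B) where

  Covered : (B → A) → (A → B) → A × B → Set
  Covered f g (x , y) = f y ≡ x ⊎ g x ≡ y

  override : ∀ {C D : Set} → DecidableEquality C → C → D → (C → D) → C → D
  override _≟_ c d f z = if does (z ≟ c) then d else f z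

  override-≡ : ∀ {C D : Set} (_≟_ : DecidableEquality C) c (d : D) f → override _≟_ c d f c ≡ d
  override-≡ _≟_ c d f rewrite dec-true (c ≟ c) refl = refl

  override-≢ : ∀ {C D : Set} (_≟_ : DecidableEquality C) {c z} (d : D) f → z ≢ c →
               override _≟_ c d f z ≡ f z
  override-≢ _≟_ {c} {z} d f z≢c rewrite dec-false (z ≟ c) z≢c = refl

  remove : ∀ {C : Set} {c : C} {l} → c ∈ l →
           ∃ λ l′ → length l ≡ suc (length l′) × (∀ {z} → z ∈ l → z ≡ c ⊎ z ∈ l′)
  remove {l = _ ∷ l} (here refl) = l , refl , λ { (here e) → inj₁ e ; (there z∈l) → inj₂ z∈l }
  remove {l = d ∷ l} (there c∈l) with l′ , e , split ← remove c∈l = d ∷ l′ , cong suc e , λ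
    { (here z≡d) → inj₂ (here z≡d)
    ; (there z∈l) → Sum.map₂ there (split z∈l) }

  two-of-three : ∀ {C : Set} {c d : C} {l} → length l ≤ 3 → c ∈ l → d ∈ l → d ≢ c →
                 ∃ λ e → ∀ {z} → z ∈ l → z ≡ c ⊎ z ≡ d ⊎ z ≡ e
  two-of-three {d = d} |l|≤3 c∈l d∈l d≢c with remove c∈l
  ... | l′ , |l|≡ , split with split d∈l
  ...   | inj₁ d≡c  = contradiction d≡c d≢c
  ...   | inj₂ d∈l′ with remove d∈l′
  -- No third element is left, so `d` is repeated as a filler.
  ...     | [] , _ , split′ = d , λ z∈l → Sum.map₂
              (λ z∈l′ → Sum.map₂ (λ ()) (split′ z∈l′)) (split z∈l)
  ...     | e ∷ [] , _ , split′ = e , λ z∈l → Sum.map₂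
              (λ z∈l′ → Sum.map₂ (λ { (here z≡e) → z≡e }) (split′ z∈l′)) (split z∈l)
  ...     | _ ∷ _ ∷ l″ , |l′|≡ , _ =
              contradiction (subst (_≤ 3) (trans |l|≡ (cong suc |l′|≡)) |l|≤3)
                λ { (s≤s (s≤s (s≤s ()))) }

  module _ (x p : A) (y y′ : B) where

    -- The pairs to cover are `(x , y)`, `(x , y′)`, some `(x′ , y)` and a last `(p , q)`. The
    -- exceptional values of the two functions serve the first two pairs, the defaults `p` and `y`
    -- the others.
    rowGuess : B → A
    rowGuess = override _≟₂_ y x (λ _ → p)

    columnGuess : A → B
    columnGuess = override _≟₁_ x y′ (λ _ → y)

    covered-corner : Covered rowGuess columnGuess (x , y)
    covered-corner = inj₁ (override-≡ _≟₂_ y x (λ _ → p))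

    covered-column : Covered rowGuess columnGuess (x , y′)
    covered-column = inj₂ (override-≡ _≟₁_ x y′ (λ _ → y))

    covered-row : ∀ {x′} → x′ ≢ x → Covered rowGuess columnGuess (x′ , y)
    covered-row x′≢x = inj₂ (override-≢ _≟₁_ y′ (λ _ → y) x′≢x)

    -- For `q ≢ y` the default `p` of `rowGuess` is right. For `q ≡ y` the pair is either the corner
    -- or, when `p ≢ x`, is hit by the default `y` of `columnGuess`.
    covered-rest : ∀ q → Covered rowGuess columnGuess (p , q)
    covered-rest q with q ≟₂ y | p ≟₁ x
    ... | no _     | _        = inj₁ refl
    ... | yes refl | yes refl = inj₁ refl
    ... | yes refl | no _     = inj₂ refl

  -- A pair having an endpoint to itself is left to that endpoint.  If the first pair shares
  -- both its endpoints, with distinct pairs (x , y′) and (x′ , y), only one more pair remains.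
  cover : A → B → ∀ l → length l ≤ 4 → ∃ λ f → ∃ λ g → All (Covered f g) l
  cover x₀ y₀ [] _ = (λ _ → x₀) , (λ _ → y₀) , []
  cover x₀ y₀ ((x , y) ∷ l) (s≤s |l|≤3)
    with f , g , cov ← cover x₀ y₀ l (ℕ.m≤n⇒m≤1+n |l|≤3)
    with any? (λ e → proj₁ e ≟₁ x) l | any? (λ e → proj₂ e ≟₂ y) l
  ... | no x∉l | _ = f , override _≟₁_ x y g , inj₂ (override-≡ _≟₁_ x y g) ∷
        All.tabulate λ {e} e∈l → Sum.map₂
          (trans (override-≢ _≟₁_ y g λ e≡x → x∉l (Any.map (λ { refl → e≡x }) e∈l)))
          (All.lookup cov e∈l)
  ... | yes _ | no y∉l = override _≟₂_ y x f , g , inj₁ (override-≡ _≟₂_ y x f) ∷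
        All.tabulate λ {e} e∈l → Sum.map₁
          (trans (override-≢ _≟₂_ x f λ e≡y → y∉l (Any.map (λ { refl → e≡y }) e∈l)))
          (All.lookup cov e∈l)
  ... | yes x∈l | yes y∈l with find x∈l | find y∈l
  ...   | (.x , y′) , c∈l , refl | (x′ , .y) , d∈l , refl with x′ ≟₁ x
  -- Here `(x′ , y)` is a second copy of the head pair, so the recursive cover already includes it.
  ...     | yes refl = f , g , All.lookup cov d∈l ∷ cov
  ...     | no x′≢x with (p , q) , split ← two-of-three |l|≤3 c∈l d∈l (x′≢x ∘ cong proj₁) =
            rowGuess x p y y′ , columnGuess x p y y′ ,
            covered-corner x p y y′ ∷ All.tabulate λ e∈l → covered (split e∈l)
    where
    covered : ∀ {e} → e ≡ (x , y′) ⊎ e ≡ (x′ , y) ⊎ e ≡ (p , q) →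
              Covered (rowGuess x p y y′) (columnGuess x p y y′) e
    covered (inj₁ refl)        = covered-column x p y y′
    covered (inj₂ (inj₁ refl)) = covered-row x p y y′ x′≢x
    covered (inj₂ (inj₂ refl)) = covered-rest x p y y′ q

-- The five strategies of a block

Hat : Set
Hat = Fin 14

shift : ℕ → Hat → Hat
shift s a = (toℕ a + s) mod 14

-- As 14 is even, parity alternates all the way round the cycle of hats, so of two successive hats
-- exactly one has a given parity.
side : Hat → Parity
side a = parity (toℕ a)

-- Of a + 1 + 2i and a + 2 + 2i modulo 14, the one of parity p.
skip : Fin 5 → Parity → Hat → Hat
skip i p a with shift (1 + 2 * toℕ i) a
... | b = if does (side b ℙ.≟ p) then b else shift 1 b

-- The hats b for which b + i never hits a are a + 1, …, a + 9, and at most five of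
-- these have a given parity.
abstract
  shift-or-skip : ∀ a b → ∃ λ i → shift (toℕ i) b ≡ a ⊎ skip i (side b) a ≡ b
  -- All 14 · 14 pairs of hats are checked by computation; `abstract` keeps it from being unfolded
  -- later.
  shift-or-skip = from-yes (Fin.all? λ a → Fin.all? λ b → Fin.any? λ i →
    (shift (toℕ i) b Fin.≟ a) ⊎-dec (skip i (side b) a Fin.≟ b))

-- Vertex `1F` bets that its side equals that of `2F`, and `2F` bets that its side differs from that
-- of `1F`. Exactly one bet is right; that inner vertex and its outer neighbour then play the two
-- alternatives of `shift-or-skip`.
blockGuess : Fin 5 → Fin 4 → (Fin 4 → Hat) → Hat
blockGuess i 0F v = shift (toℕ i) (v 1F)
blockGuess i 1F v = skip i (side (v 2F)) (v 0F)
blockGuess i 2F v = skip i (side (v 1F) ⁻¹) (v 3F)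
blockGuess i 3F v = shift (toℕ i) (v 2F)

blockGuess-local : ∀ i j {v w : Fin 4 → Hat} → (∀ k → Consecutive j k → v k ≡ w k) →
                   blockGuess i j v ≡ blockGuess i j w
blockGuess-local i 0F e = cong (shift (toℕ i)) (e 1F (inj₁ refl))
blockGuess-local i 1F e = cong₂ (skip i ∘ side) (e 2F (inj₁ refl)) (e 0F (inj₂ refl))
blockGuess-local i 2F e = cong₂ (λ b → skip i (side b ⁻¹)) (e 1F (inj₂ refl)) (e 3F (inj₁ refl))
blockGuess-local i 3F e = cong (shift (toℕ i)) (e 2F (inj₂ refl))

BlockWins : Fin 5 → (Fin 4 → Hat) → Set
BlockWins i v = ∃ λ j → blockGuess i j v ≡ v j

blockWins? : ∀ i v → Dec (BlockWins i v)
blockWins? i v = Fin.any? λ j → blockGuess i j v Fin.≟ v j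

≢⇒≡⁻¹ : ∀ p q → p ≢ q → q ≡ p ⁻¹
≢⇒≡⁻¹ 0ℙ 0ℙ p≢q = contradiction refl p≢q
≢⇒≡⁻¹ 0ℙ 1ℙ _   = refl
≢⇒≡⁻¹ 1ℙ 0ℙ _   = refl
≢⇒≡⁻¹ 1ℙ 1ℙ p≢q = contradiction refl p≢q

-- The outer pair at the first end wins when the inner hats have equal parity, and the pair
-- at the other end wins otherwise.
some-block-strategy-wins : ∀ v → ∃ λ i → BlockWins i v
some-block-strategy-wins v with side (v 1F) ℙ.≟ side (v 2F)
... | yes same with shift-or-skip (v 0F) (v 1F)
...   | i , inj₁ e = i , 0F , e
...   | i , inj₂ e = i , 1F , trans (cong (λ p → skip i p (v 0F)) (≡-sym same)) e
some-block-strategy-wins v | no differ with shift-or-skip (v 3F) (v 2F)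
...   | i , inj₁ e = i , 3F , e
...   | i , inj₂ e = i , 2F ,
        trans (cong (λ p → skip i p (v 3F)) (≡-sym (≢⇒≡⁻¹ (side (v 1F)) (side (v 2F)) differ))) e

-- Candidate pairs and the strategy on the double fan

lookup-injective : ∀ {A : Set} {l : List A} → Unique l → ∀ i j → lookup l i ≡ lookup l j → i ≡ j
lookup-injective (_   ∷ _)  zero    zero    _ = refl
lookup-injective (a∉l ∷ _)  zero    (suc j) e = contradiction e (All.lookup a∉l (∈-lookup j))
lookup-injective (a∉l ∷ _)  (suc i) zero    e =
  contradiction (≡-sym e) (All.lookup a∉l (∈-lookup i))
lookup-injective (_   ∷ ul) (suc i) (suc j) e = cong suc (lookup-injective ul i j e)

-- This turns five distinct candidate pairs into a labelling of all pairs that numbers those five;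
-- off the image of `e` the label `zero` is an arbitrary choice.
injective⇒leftInverse : ∀ {A : Set} {m} → DecidableEquality A → (e : Fin (suc m) → A) →
                        (∀ i j → e i ≡ e j → i ≡ j) → ∃ λ (h : A → Fin (suc m)) → ∀ i → h (e i) ≡ i
injective⇒leftInverse {A} {m} _≟_ e e-inj = h , h∘e
  where
  h : A → Fin (suc m)
  h a with Fin.any? (λ i → e i ≟ a)
  ... | yes (i , _) = i
  ... | no _        = zero
  h∘e : ∀ i → h (e i) ≡ i
  h∘e i with Fin.any? (λ j → e j ≟ e i)
  ... | yes (j , ej≡ei) = e-inj j i ej≡ei
  ... | no ∄j           = contradiction (i , refl) ∄j

-- `F b x y` is the strategy that block `b` plays on seeing apex hats `x` and `y`. Pointwise
-- agreement avoids function extensionality.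
Universal : ∀ {N} → (Fin N → Hat → Hat → Fin 5) → Set
Universal F = ∀ (h : Hat × Hat → Fin 5) → ∃ λ b → ∀ x y → F b x y ≡ h (x , y)

module Game {N : ℕ} (F : Fin N → Hat → Hat → Fin 5) (universal : Universal F) where

  G : Graph
  G = doubleFan (N * 4)

  blockVertex : Fin N → Fin 4 → Fin (2 + N * 4)
  blockVertex b j = pathVertex (combine b j)

  blockVertex-adj : ∀ b {j k} → Consecutive j k → Adj G (blockVertex b j) (blockVertex b k)
  blockVertex-adj b {j} {k} jk = consecutive⇒adj {i = combine b j} {combine b k}
    (Sum.map (next j k) (next k j) jk)
    where
    next : ∀ j k → suc (toℕ j) ≡ toℕ k → suc (toℕ (combine b j)) ≡ toℕ (combine b k)
    next j k e = begin
      suc (toℕ (combine b j))      ≡⟨ cong suc (Fin.toℕ-combine b j) ⟩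
      suc (4 * toℕ b + toℕ j)      ≡⟨ ℕ.+-suc (4 * toℕ b) (toℕ j) ⟨
      4 * toℕ b + suc (toℕ j)      ≡⟨ cong (λ t → 4 * toℕ b + t) e ⟩
      4 * toℕ b + toℕ k            ≡⟨ Fin.toℕ-combine b k ⟨
      toℕ (combine b k)            ∎
      where open ≡-Reasoning

  -- Vectors rather than functions: pointwise equal path colourings become equal after tabulation,
  -- which gives the locality of the apex guesses without function extensionality.
  PathColouring : Set
  PathColouring = Vec.Vec Hat (N * 4)

  blockHats : PathColouring → Fin N → Fin 4 → Hat
  blockHats p b j = Vec.lookup p (combine b j)

  -- Here `(x , y)` is a hypothetical pair of apex hats, so an apex can test every pair from the
  -- path colouring alone.
  SomeBlockWins : PathColouring → Hat × Hat → Set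
  SomeBlockWins p (x , y) = ∃ λ b → BlockWins (F b x y) (blockHats p b)

  someBlockWins? : ∀ p xy → Dec (SomeBlockWins p xy)
  someBlockWins? p (x , y) = Fin.any? λ b → blockWins? (F b x y) (blockHats p b)

  hatPairs : List (Hat × Hat)
  hatPairs = cartesianProduct (allFin 14) (allFin 14)

  candidates : PathColouring → List (Hat × Hat)
  candidates p = filter (λ xy → ¬? (someBlockWins? p xy)) hatPairs

  candidates-unique : ∀ p → Unique (candidates p)
  candidates-unique p = Unique.filter⁺ (λ xy → ¬? (someBlockWins? p xy))
    (Unique.cartesianProduct⁺ (Unique.allFin⁺ 14) (Unique.allFin⁺ 14))

  ∈-candidates : ∀ p {x y} → ¬ SomeBlockWins p (x , y) → (x , y) ∈ candidates p
  ∈-candidates p {x} {y} = ∈-filter⁺ (λ xy → ¬? (someBlockWins? p xy))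
    (∈-cartesianProduct⁺ (∈-allFin x) (∈-allFin y))

  candidates-few : ∀ p → length (candidates p) ≤ 4
  candidates-few p with length (candidates p) ≤? 4
  ... | yes ≤4 = ≤4
  ... | no ≰4 = contradiction
        (b , subst (λ k → BlockWins k (blockHats p b)) (≡-sym (trans (Fb≡h _ _) (h∘e i))) wins)
        (proj₂ (∈-filter⁻ (λ xy → ¬? (someBlockWins? p xy)) {xs = hatPairs}
          (∈-lookup {xs = candidates p} (inject≤ i 5≤))))
    where
    5≤ : 5 ≤ length (candidates p)
    5≤ = ℕ.≰⇒> ≰4
    e : Fin 5 → Hat × Hat
    e i = lookup (candidates p) (inject≤ i 5≤)
    leftInverse = injective⇒leftInverse (≡-dec Fin._≟_ Fin._≟_) e
      λ i j ei≡ej → Fin.inject≤-injective 5≤ 5≤ i j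
        (lookup-injective (candidates-unique p) _ _ ei≡ej)
    h = proj₁ leftInverse
    h∘e = proj₂ leftInverse
    b = proj₁ (universal h)
    Fb≡h = proj₂ (universal h)
    -- Strategy `i` wins on the hats of block `b`, and `b` plays it when the apexes wear `e i`, so
    -- `e i` cannot be a candidate.
    i = proj₁ (some-block-strategy-wins (blockHats p b))
    wins = proj₂ (some-block-strategy-wins (blockHats p b))

  open Covering (Fin._≟_ {14}) (Fin._≟_ {14})

  apexGuesses : ∀ p → ∃ λ f → ∃ λ g → All (Covered f g) (candidates p)
  apexGuesses p = cover 0F 0F (candidates p) (candidates-few p)

  apexGuess₀ apexGuess₁ : PathColouring → Hat → Hat
  apexGuess₀ p = proj₁ (apexGuesses p)
  apexGuess₁ p = proj₁ (proj₂ (apexGuesses p))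

  pathColouring : Colouring G 14 → PathColouring
  pathColouring c = Vec.tabulate (c ∘ pathVertex)

  pathVertexGuess : Fin N × Fin 4 → Colouring G 14 → Hat
  pathVertexGuess (b , j) c = blockGuess (F b (c 0F) (c 1F)) j (c ∘ blockVertex b)

  guess′ : Fin (2 + N * 4) → Colouring G 14 → Hat
  guess′ 0F            c = apexGuess₀ (pathColouring c) (c 1F)
  guess′ 1F            c = apexGuess₁ (pathColouring c) (c 0F)
  guess′ (suc (suc i)) c = pathVertexGuess (remQuot {N} 4 i) c

  local′ : ∀ v (c c′ : Colouring G 14) → (∀ u → Adj G v u → c u ≡ c′ u) → guess′ v c ≡ guess′ v c′
  local′ 0F c c′ eq = cong₂ apexGuess₀
    (tabulate-cong λ i → eq (pathVertex i) refl) (eq 1F refl)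
  local′ 1F c c′ eq = cong₂ apexGuess₁
    (tabulate-cong λ i → eq (pathVertex i) refl) (eq 0F refl)
  local′ (suc (suc i)) c c′ eq = begin
    blockGuess (F b (c 0F) (c 1F)) j (c ∘ blockVertex b)
      ≡⟨ cong (λ k → blockGuess k j (c ∘ blockVertex b)) (cong₂ (F b) (eq 0F refl) (eq 1F refl)) ⟩
    blockGuess (F b (c′ 0F) (c′ 1F)) j (c ∘ blockVertex b)
      ≡⟨ blockGuess-local (F b (c′ 0F) (c′ 1F)) j (λ k jk → eq (blockVertex b k)
           (subst (λ u → Adj G u (blockVertex b k))
             (cong pathVertex (Fin.combine-remQuot {N} 4 i)) (blockVertex-adj b jk))) ⟩
    blockGuess (F b (c′ 0F) (c′ 1F)) j (c′ ∘ blockVertex b) ∎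
    where
    open ≡-Reasoning
    b = proj₁ (remQuot {N} 4 i)
    j = proj₂ (remQuot {N} 4 i)

  strategy : Strategy G 14
  strategy = record { guess = guess′ ; local = local′ }

  winning : Winning G 14 strategy
  winning c with someBlockWins? (pathColouring c) (c 0F , c 1F)
  ... | yes (b , j , right) = blockVertex b j , (begin
    pathVertexGuess (remQuot {N} 4 (combine b j)) c
      ≡⟨ cong (λ bj → pathVertexGuess bj c) (Fin.remQuot-combine b j) ⟩
    blockGuess (F b (c 0F) (c 1F)) j (c ∘ blockVertex b)
      ≡⟨ blockGuess-local (F b (c 0F) (c 1F)) j (λ k _ → hats k) ⟨
    blockGuess (F b (c 0F) (c 1F)) j (blockHats (pathColouring c) b)
      ≡⟨ right ⟩
    blockHats (pathColouring c) b j
      ≡⟨ hats j ⟩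
    c (blockVertex b j) ∎)
    where
    open ≡-Reasoning
    hats : ∀ k → blockHats (pathColouring c) b k ≡ c (blockVertex b k)
    hats k = lookup∘tabulate (c ∘ pathVertex) (combine b k)
  -- No block wins for the actual apex hats, so these form a candidate pair, and `Covered` says
  -- precisely that one of the two apexes guesses right.
  ... | no none = Sum.[ (0F ,_) , (1F ,_) ]
    (All.lookup (proj₂ (proj₂ (apexGuesses (pathColouring c)))) (∈-candidates (pathColouring c) none))

-- There are `5 ^ (14 * 14)` functions from pairs of hats to strategies; the number `b` of a block
-- encodes its function by base 5 digits.
universalFamily : ∃ λ N → Σ (Fin N → Hat → Hat → Fin 5) Universal
universalFamily = 5 ^ (14 * 14) , (λ b x y → finToFun b (combine x y)) , λ h →
  funToFin (h ∘ remQuot 14) , λ x y →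
    trans (Fin.finToFun-funToFin (h ∘ remQuot 14) (combine x y)) (cong h (Fin.remQuot-combine x y))

theorem6 : Σ Graph λ G → Planar G × HG≥ G 14
-- Matching turns `N` into a variable, so nothing here computes with the huge number of blocks.
theorem6 with N , F , universal ← universalFamily =
  doubleFan (N * 4) , doubleFan-planar (N * 4) , 14 , ℕ.≤-refl , strategy , winning
  where open Game F universal
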